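{- Let $G$ be a graph with vertex set $V(G)=\{u_1,\ldots,u_n\}$ and let $H_1,\ldots,H_n$ be pairwise disjoint graphs such that at least one of the $H_i$ is not a complete graph. Let $M=\max\Big\{\sum_{j=1}^k box(H_{i_j}) : \{u_{i_1},\ldots,u_{i_k}\}\text{ is a clique in } G \text{ and each } H_{i_j} \text{ is not a complete graph}\Big\}.$ Then $M\leq box(G[H_1,H_2,\ldots,H_n])\leq \sum_{i=1}^n box(H_i)$.
   Context: All graphs are simple, finite and undirected. For a graph $G$ with vertex set $\{u_1,\ldots,u_n\}$ and pairwise disjoint graphs $H_1,\ldots,H_n$, the $G$-generalized join $G[H_1,\ldots,H_n]$ is the graph obtained from $G$ by replacing each vertex $u_i$ by $H_i$ and joining every vertex of $H_i$ to every vertex of $H_j$ whenever $u_i$ is adjacent to $u_j$ in $G$ (no other edges between different $H_i$'s). An $\ell$-box is a Cartesian product of $\ell$ closed bounded real intervals; the boxicity $box(G)$ of a graph $G$ is the least positive integer $\ell$ such that $G$ is isomorphic to the intersection graph of a family of $\ell$-boxes. A clique in $G$ is a set of pairwise adjacent vertices (a single vertex is a clique). -}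

module Defs where

open import Level using (Level; 0ℓ; _⊔_) renaming (suc to lsuc)
open import Data.Bool.Base using (if_then_else_)
open import Data.Fin.Base using (Fin)
open import Data.Fin.Subset using (Subset; Nonempty; _∈_)
open import Data.Nat.Base using (ℕ; _≤_)
open import Data.Nat.Properties using (+-0-commutativeMonoid)
open import Data.Product.Base using (∃; ∃-syntax; Σ-syntax; _×_; _,_)
open import Data.Rational.Base using (ℚ) renaming (_<_ to _<ℚ_)
open import Data.Sum.Base using (_⊎_; inj₁; inj₂)
open import Data.Vec.Base using (lookup)
open import Function.Bundles using (_⇔_; _↔_; Inverse)
open import Relation.Binary.PropositionalEquality using (_≡_; _≢_; refl; sym; subst)
open import Relation.Nullary using (¬_)
open import Algebra.Properties.CommutativeMonoid.Sum +-0-commutativeMonoid public using (sum)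

private
  variable
    a b c : Level

-- Real numbers as two-sided Dedekind cuts of ℚ.

record ℝ : Set₁ where
  field
    L U         : ℚ → Set
    L-inhabited : ∃ L
    U-inhabited : ∃ U
    L-rounded   : ∀ q → L q ⇔ (∃[ r ] (q <ℚ r × L r))
    U-rounded   : ∀ q → U q ⇔ (∃[ r ] (r <ℚ q × U r))
    disjoint    : ∀ q → ¬ (L q × U q)
    located     : ∀ p q → p <ℚ q → L p ⊎ U q

_≤ᴿ_ : ℝ → ℝ → Set
x ≤ᴿ y = ∀ q → ℝ.L x q → ℝ.L y q

record Interval : Set₁ where
  field
    left right : ℝ
    left≤right : left ≤ᴿ right

_∈ᴵ_ : ℝ → Interval → Set
x ∈ᴵ I = (Interval.left I ≤ᴿ x) × (x ≤ᴿ Interval.right I)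

Box : ℕ → Set₁
Box ℓ = Fin ℓ → Interval

_∈ᴮ_ : ∀ {ℓ} → (Fin ℓ → ℝ) → Box ℓ → Set
p ∈ᴮ B = ∀ d → p d ∈ᴵ B d

Intersect : ∀ {ℓ} → Box ℓ → Box ℓ → Set₁
Intersect B C = ∃[ p ] (p ∈ᴮ B × p ∈ᴮ C)

-- Simple undirected graphs on a given vertex set; a finite graph is one whose
-- vertex set is some Fin n (or a finite disjoint union of such).

record Graph (V : Set a) b : Set (a ⊔ lsuc b) where
  field
    Adj     : V → V → Set b
    adj-sym : ∀ {u v} → Adj u v → Adj v u
    irrefl  : ∀ {v} → ¬ Adj v v

open Graph public

record _≅_ {V W : Set a} (G : Graph V b) (H : Graph W c) : Set (a ⊔ b ⊔ c) where
  field
    vertices : V ↔ W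
    edges    : ∀ u v → Adj G u v ⇔ Adj H (Inverse.to vertices u) (Inverse.to vertices v)

Complete : {V : Set a} → Graph V b → Set (a ⊔ b)
Complete G = ∀ u v → u ≢ v → Adj G u v

IsClique : ∀ {n} → Graph (Fin n) b → Subset n → Set b
IsClique G S = Nonempty S × (∀ u v → u ∈ S → v ∈ S → u ≢ v → Adj G u v)

-- The family may repeat a box, so distinctness refers to the indices.
intersectionGraph : ∀ {ℓ} {W : Set} → (W → Box ℓ) → Graph W (lsuc 0ℓ)
intersectionGraph B = record
  { Adj     = λ u v → u ≢ v × Intersect (B u) (B v)
  ; adj-sym = λ { (u≢v , p , p∈u , p∈v) → (λ v≡u → u≢v (sym v≡u)) , p , p∈v , p∈u }
  ; irrefl  = λ { (v≢v , _) → v≢v refl }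
  }

IsBoxGraph : {V : Set} → Graph V b → ℕ → Set (b ⊔ lsuc 0ℓ)
IsBoxGraph G ℓ = Σ[ W ∈ Set ] Σ[ B ∈ (W → Box ℓ) ] (G ≅ intersectionGraph B)

IsLeast IsGreatest : (ℕ → Set a) → ℕ → Set a
IsLeast    P m = P m × (∀ k → P k → m ≤ k)
IsGreatest P m = P m × (∀ k → P k → k ≤ m)

-- Boxicity as a functional relation: "box(G) = ℓ".
IsBoxicity : {V : Set} → Graph V b → ℕ → Set (b ⊔ lsuc 0ℓ)
IsBoxicity G = IsLeast (λ ℓ → 1 ≤ ℓ × IsBoxGraph G ℓ)

-- The generalized join G[H₁,…,Hₙ]. The pair (i , x) is the vertex x of Hᵢ, so the
-- Hᵢ are made disjoint by tagging.

module _ {n : ℕ} {m : Fin n → ℕ}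
         (G : Graph (Fin n) b) (H : ∀ i → Graph (Fin (m i)) b) where

  JoinVertex : Set
  JoinVertex = Σ[ i ∈ Fin n ] Fin (m i)

  JoinAdj : JoinVertex → JoinVertex → Set b
  JoinAdj (i , x) (j , y) =
    Adj G i j ⊎ (Σ[ i≡j ∈ i ≡ j ] Adj (H j) (subst (λ k → Fin (m k)) i≡j x) y)

  join : Graph JoinVertex b
  join = record { Adj = JoinAdj ; adj-sym = join-sym ; irrefl = join-irrefl }
    where
    join-sym : ∀ {u v} → JoinAdj u v → JoinAdj v u
    join-sym (inj₁ e) = inj₁ (adj-sym G e)
    join-sym {i , _} (inj₂ (refl , e)) = inj₂ (refl , adj-sym (H i) e)

    join-irrefl : ∀ {v} → ¬ JoinAdj v v
    join-irrefl (inj₁ e) = irrefl G e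
    join-irrefl {i , _} (inj₂ (refl , e)) = irrefl (H i) e

sumOver : ∀ {n} → Subset n → (Fin n → ℕ) → ℕ
sumOver S f = sum (λ i → if lookup S i then f i else 0)

-- The values over which M is the maximum, where β i stands for box(Hᵢ).
IsCliqueSum : ∀ {n} {m : Fin n → ℕ} → Graph (Fin n) b → (∀ i → Graph (Fin (m i)) b) →
              (Fin n → ℕ) → ℕ → Set b
IsCliqueSum {n = n} G H β s =
  Σ[ S ∈ Subset n ] (IsClique G S × (∀ i → i ∈ S → ¬ Complete (H i)) × s ≡ sumOver S β)

{-# OPTIONS --safe #-}

-- Upper bound: give every Hᵢ its own box(Hᵢ) dimensions. In those, Hᵢ keeps its intervals, the
-- vertices over neighbours of uᵢ get an interval [p , q] containing all of them, and the
-- remaining vertices get the point q lying strictly to the right of Hᵢ.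
-- Lower bound: if a dimension separates two vertices of Hᵢ, all intervals meeting both contain
-- the gap between them, so it separates no two vertices of Hⱼ for any uⱼ adjacent to uᵢ.
-- Hence over a clique the sets of separating dimensions are pairwise disjoint, and the
-- dimensions separating vertices of Hᵢ already represent Hᵢ, so there are at least box(Hᵢ).
-- Both conclusions are ¬¬-stable, so finitely many instances of excluded middle are available.

module Submission where

open import Defs
open import Level using (0ℓ)
open import Data.Bool.Base using (true; false; if_then_else_)
open import Data.Empty using (⊥-elim)
open import Data.Fin.Base using (Fin; zero; suc; inject≤)
open import Data.Fin.Properties using (_≟_; +↔⊎; injective⇒≤; inject≤-injective; ¬Fin0)
open import Data.Fin.Subset using (_∈_)
open import Data.Nat.Base using (ℕ; zero; suc; _≤_; z≤n; s≤s)
open import Data.Nat.Properties using (_≤?_; n≢0⇒n>0)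
open import Data.Product.Base using (∃; ∃-syntax; Σ-syntax; _×_; _,_; proj₁; proj₂)
open import Data.Rational.Base using (ℚ; 0ℚ; 1ℚ) renaming (_<_ to _<ℚ_; _≤_ to _≤ℚ_)
import Data.Rational.Base as ℚ
import Data.Rational.Properties as ℚ
open import Data.Sum.Base using (_⊎_; inj₁; inj₂)
open import Data.Sum.Function.Propositional using (_⊎-↔_)
open import Data.Vec.Base using (lookup)
open import Data.Vec.Properties using (lookup⇒[]=)
open import Function.Base using (_∘_; flip)
open import Function.Bundles using (_⇔_; _↔_; mk⇔; mk↔ₛ′; Equivalence; Inverse)
open import Function.Definitions using (Injective)
open import Function.Properties.Inverse using (↔-refl; ↔-trans)
open import Relation.Binary.PropositionalEquality using (_≡_; _≢_; refl; sym; trans; cong; subst; subst₂)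
open import Relation.Nullary using (¬_; Dec; yes; no; contradiction)
open import Relation.Nullary.Decidable using (decidable-stable; ¬¬-excluded-middle)

open ℝ using (L; U)
open Interval
open Equivalence using () renaming (to to to⇔; from to from⇔)
open Inverse using () renaming (to to to↔; from to from↔)

-- Excluded middle over finite index sets, and counting

-- Double negation commutes with finite conjunctions, so induction on `n` collects one instance of
-- excluded middle per index. A proof of a stable goal may then assume that `P` is decided
-- everywhere.
¬¬-decidable : ∀ {a n} (P : Fin n → Set a) → ¬ ¬ (∀ i → Dec (P i))
¬¬-decidable {n = zero}  P ¬dec = ¬dec λ ()
¬¬-decidable {n = suc _} P ¬dec =
  ¬¬-excluded-middle λ P0? → ¬¬-decidable (P ∘ suc) λ P? →
  ¬dec λ { zero → P0? ; (suc i) → P? i }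

¬¬-decidable₂ : ∀ {a m n} (P : Fin m → Fin n → Set a) → ¬ ¬ (∀ i j → Dec (P i j))
¬¬-decidable₂ {m = zero}  P ¬dec = ¬dec λ ()
¬¬-decidable₂ {m = suc _} P ¬dec =
  ¬¬-decidable (P zero) λ P0? → ¬¬-decidable₂ (P ∘ suc) λ P? →
  ¬dec λ { zero → P0? ; (suc i) → P? i }

Σ-suc↔ : ∀ {a n} {A : Fin (suc n) → Set a} →
         (A zero ⊎ (Σ[ i ∈ Fin n ] A (suc i))) ↔ (Σ[ i ∈ Fin (suc n) ] A i)
Σ-suc↔ = mk↔ₛ′
  (λ { (inj₁ x) → zero , x ; (inj₂ (i , x)) → suc i , x })
  (λ { (zero , x) → inj₁ x ; (suc i , x) → inj₂ (i , x) })
  (λ { (zero , _) → refl ; (suc _ , _) → refl })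
  (λ { (inj₁ _) → refl ; (inj₂ _) → refl })

sum↔Σ : ∀ {n} (f : Fin n → ℕ) → Fin (sum f) ↔ (Σ[ i ∈ Fin n ] Fin (f i))
sum↔Σ {zero}  f = mk↔ₛ′ (λ ()) (λ { (() , _) }) (λ { (() , _) }) (λ ())
sum↔Σ {suc n} f = ↔-trans +↔⊎ (↔-trans (↔-refl ⊎-↔ sum↔Σ (f ∘ suc)) Σ-suc↔)

↔-injective : ∀ {a b} {A : Set a} {B : Set b} (e : A ↔ B) → Injective _≡_ _≡_ (to↔ e)
↔-injective e {x} {y} eq =
  trans (sym (Inverse.strictlyInverseʳ e x)) (trans (cong (from↔ e) eq) (Inverse.strictlyInverseʳ e y))

Fin⇒1≤ : ∀ {n} → Fin n → 1 ≤ n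
Fin⇒1≤ {suc _} _ = s≤s z≤n

1≤⇒Fin : ∀ {n} → 1 ≤ n → Fin n
1≤⇒Fin (s≤s _) = zero

-- Together the maps `e i` form one injection of the disjoint union into `Fin ℓ`, and that union has
-- `sum f` elements.
disjointInjections⇒sum≤ : ∀ {n ℓ} {f : Fin n → ℕ} (e : ∀ i → Fin (f i) → Fin ℓ) →
  (∀ i → Injective _≡_ _≡_ (e i)) → (∀ {i j} x y → e i x ≡ e j y → i ≡ j) → sum f ≤ ℓ
disjointInjections⇒sum≤ {f = f} e e-inj e-disj =
  injective⇒≤ {f = λ k → tagged (to↔ (sum↔Σ f) k)} (↔-injective (sum↔Σ f) ∘ tagged-injective)
  where
  tagged : (Σ[ i ∈ Fin _ ] Fin (f i)) → Fin _
  tagged (i , x) = e i x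

  tagged-injective : Injective _≡_ _≡_ tagged
  tagged-injective {i , x} {j , y} eq with refl ← e-disj x y eq = cong (i ,_) (e-inj i eq)

record Enumeration {ℓ} (P : Fin ℓ → Set) : Set where
  field
    size       : ℕ
    enum       : Fin size → Fin ℓ
    injective  : Injective _≡_ _≡_ enum
    sound      : ∀ c → P (enum c)
    complete   : ∀ {d} → P d → ∃[ c ] enum c ≡ d

open Enumeration

enumerate : ∀ {ℓ} {P : Fin ℓ → Set} → (∀ d → Dec (P d)) → Enumeration P
enumerate {ℓ} {P} P? = record
  -- Each `d` contributes a block of one element if `P d` holds and an empty block otherwise, so the
  -- disjoint union of the blocks is the subset itself.
  { size      = sum (λ d → weight (P? d))
  ; enum      = proj₁ ∘ to↔ dims
  ; injective = λ eq → ↔-injective dims (proj₁-injective eq)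
  ; sound     = λ c → holds (P? _) (proj₂ (to↔ dims c))
  ; complete  = λ Pd → from↔ dims (_ , unit (P? _) Pd) , cong proj₁ (Inverse.strictlyInverseˡ dims _)
  }
  where
  weight : ∀ {A : Set} → Dec A → ℕ
  weight (yes _) = 1
  weight (no  _) = 0

  dims : Fin (sum (λ d → weight (P? d))) ↔ (Σ[ d ∈ Fin ℓ ] Fin (weight (P? d)))
  dims = sum↔Σ _

  holds : ∀ {A : Set} (A? : Dec A) → Fin (weight A?) → A
  holds (yes a) _ = a

  unit : ∀ {A : Set} (A? : Dec A) → A → Fin (weight A?)
  unit (yes _) _ = zero
  unit (no ¬a) a = ⊥-elim (¬a a)

  unique : ∀ {A : Set} (A? : Dec A) (x y : Fin (weight A?)) → x ≡ y
  unique (yes _) zero zero = refl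

  proj₁-injective : ∀ {x y : Σ[ d ∈ Fin ℓ ] Fin (weight (P? d))} → proj₁ x ≡ proj₁ y → x ≡ y
  proj₁-injective {d , x} {_ , y} refl = cong (d ,_) (unique (P? d) x y)

-- Dedekind reals

L-downward : ∀ x {p q} → p <ℚ q → L x q → L x p
L-downward x p<q q∈L = from⇔ (ℝ.L-rounded x _) (_ , p<q , q∈L)

U-upward : ∀ x {p q} → p <ℚ q → U x p → U x q
U-upward x p<q p∈U = from⇔ (ℝ.U-rounded x _) (_ , p<q , p∈U)

L-downward-≤ : ∀ x {p q} → p ≤ℚ q → L x q → L x p
L-downward-≤ x p≤q q∈L = let r , q<r , r∈L = to⇔ (ℝ.L-rounded x _) q∈L in
  L-downward x (ℚ.≤-<-trans p≤q q<r) r∈L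

U-upward-≤ : ∀ x {p q} → p ≤ℚ q → U x p → U x q
U-upward-≤ x p≤q p∈U = let r , r<p , r∈U = to⇔ (ℝ.U-rounded x _) p∈U in
  U-upward x (ℚ.<-≤-trans r<p p≤q) r∈U

L<U : ∀ x {p q} → L x p → U x q → p <ℚ q
L<U x {p} {q} p∈L q∈U with p ℚ.<? q
... | yes p<q = p<q
... | no  p≮q = contradiction (p∈L , U-upward-≤ x (ℚ.≮⇒≥ p≮q) q∈U) (ℝ.disjoint x p)

≤ᴿ-refl : ∀ {x} → x ≤ᴿ x
≤ᴿ-refl _ q∈L = q∈L

L∩U⇒≤ᴿ : ∀ x y {q} → U x q → L y q → x ≤ᴿ y
L∩U⇒≤ᴿ x y q∈U q∈L r r∈L = L-downward y (L<U x r∈L q∈U) q∈L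

L∩U⇒≰ᴿ : ∀ x y {q} → L x q → U y q → ¬ (x ≤ᴿ y)
L∩U⇒≰ᴿ x y q∈L q∈U x≤y = ℝ.disjoint y _ (x≤y _ q∈L , q∈U)

-- Roundedness provides some `r` above `q` that is still below `x`. Locating `y` between `q` and `r`
-- either gives the goal or makes `r` a witness that `x ≤ᴿ y` fails.
≤ᴿ-stable : ∀ x y → ¬ ¬ (x ≤ᴿ y) → x ≤ᴿ y
≤ᴿ-stable x y ¬x≰y q q∈L with to⇔ (ℝ.L-rounded x q) q∈L
... | r , q<r , r∈L with ℝ.located y q r q<r
...   | inj₁ q∈Ly = q∈Ly
...   | inj₂ r∈Uy = contradiction (L∩U⇒≰ᴿ x y r∈L r∈Uy) ¬x≰y

≰ᴿ⇒≥ᴿ : ∀ x y → ¬ (x ≤ᴿ y) → y ≤ᴿ x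
≰ᴿ⇒≥ᴿ x y x≰y q q∈L with to⇔ (ℝ.L-rounded y q) q∈L
... | r , q<r , r∈L with ℝ.located x q r q<r
...   | inj₁ q∈Lx = q∈Lx
...   | inj₂ r∈Ux = contradiction (L∩U⇒≤ᴿ x y r∈Ux r∈L) x≰y

fromℚ : ℚ → ℝ
fromℚ p = record
  { L           = _<ℚ p
  ; U           = p <ℚ_
  ; L-inhabited = p ℚ.- 1ℚ , p-1<p
  ; U-inhabited = p ℚ.+ 1ℚ , p<p+1
  ; L-rounded   = λ q → mk⇔ (λ q<p → let r , q<r , r<p = ℚ.<-dense q<p in r , q<r , r<p)
                            (λ (r , q<r , r<p) → ℚ.<-trans q<r r<p)
  ; U-rounded   = λ q → mk⇔ (λ p<q → let r , p<r , r<q = ℚ.<-dense p<q in r , r<q , p<r)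
                            (λ (r , r<q , p<r) → ℚ.<-trans p<r r<q)
  ; disjoint    = λ q (q<p , p<q) → ℚ.<-asym q<p p<q
  ; located     = located
  }
  where
  p<p+1 : p <ℚ p ℚ.+ 1ℚ
  p<p+1 = subst (_<ℚ p ℚ.+ 1ℚ) (ℚ.+-identityʳ p) (ℚ.+-monoʳ-< p (ℚ.positive⁻¹ 1ℚ))

  p-1<p : p ℚ.- 1ℚ <ℚ p
  p-1<p = subst (p ℚ.- 1ℚ <ℚ_) (ℚ.+-identityʳ p) (ℚ.+-monoʳ-< p (ℚ.negative⁻¹ (ℚ.- 1ℚ)))

  located : ∀ q r → q <ℚ r → q <ℚ p ⊎ p <ℚ r
  located q r q<r with q ℚ.<? p
  ... | yes q<p = inj₁ q<p
  ... | no  q≮p = inj₂ (ℚ.≤-<-trans (ℚ.≮⇒≥ q≮p) q<r)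

fromℚ-mono : ∀ {p q} → p ≤ℚ q → fromℚ p ≤ᴿ fromℚ q
fromℚ-mono p≤q r r<p = ℚ.<-≤-trans r<p p≤q

L⇒fromℚ≤ᴿ : ∀ x {p} → L x p → fromℚ p ≤ᴿ x
L⇒fromℚ≤ᴿ x p∈L q q<p = L-downward x q<p p∈L

U⇒≤ᴿfromℚ : ∀ x {p} → U x p → x ≤ᴿ fromℚ p
U⇒≤ᴿfromℚ x p∈U q q∈L = L<U x q∈L p∈U

U⇒fromℚ≰ᴿ : ∀ x {p} → U x p → ¬ (fromℚ p ≤ᴿ x)
U⇒fromℚ≰ᴿ x p∈U = let r , r<p , r∈U = to⇔ (ℝ.U-rounded x _) p∈U in L∩U⇒≰ᴿ (fromℚ _) x r<p r∈U

_⊔ᴿ_ : ℝ → ℝ → ℝ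
x ⊔ᴿ y = record
  { L           = λ q → L x q ⊎ L y q
  ; U           = λ q → U x q × U y q
  ; L-inhabited = let q , q∈L = ℝ.L-inhabited x in q , inj₁ q∈L
  ; U-inhabited = let q , q∈U = ℝ.U-inhabited x
                      r , r∈U = ℝ.U-inhabited y
                  in q ℚ.⊔ r , U-upward-≤ x (ℚ.p≤p⊔q q r) q∈U , U-upward-≤ y (ℚ.p≤q⊔p q r) r∈U
  ; L-rounded   = λ q → mk⇔ (λ { (inj₁ q∈L) → let r , q<r , r∈L = to⇔ (ℝ.L-rounded x q) q∈L in r , q<r , inj₁ r∈L
                               ; (inj₂ q∈L) → let r , q<r , r∈L = to⇔ (ℝ.L-rounded y q) q∈L in r , q<r , inj₂ r∈L })
                            (λ { (r , q<r , inj₁ r∈L) → inj₁ (L-downward x q<r r∈L)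
                               ; (r , q<r , inj₂ r∈L) → inj₂ (L-downward y q<r r∈L) })
  ; U-rounded   = λ q → mk⇔ U-open (λ (r , r<q , r∈Ux , r∈Uy) → U-upward x r<q r∈Ux , U-upward y r<q r∈Uy)
  ; disjoint    = λ { q (inj₁ q∈L , q∈U , _) → ℝ.disjoint x q (q∈L , q∈U)
                    ; q (inj₂ q∈L , _ , q∈U) → ℝ.disjoint y q (q∈L , q∈U) }
  ; located     = located
  }
  where
  U-open : ∀ {q} → U x q × U y q → ∃[ r ] (r <ℚ q × U x r × U y r)
  U-open (q∈Ux , q∈Uy) =
    let r , r<q , r∈U = to⇔ (ℝ.U-rounded x _) q∈Ux
        s , s<q , s∈U = to⇔ (ℝ.U-rounded y _) q∈Uy
    in r ℚ.⊔ s , ⊔-lub-< r<q s<q , U-upward-≤ x (ℚ.p≤p⊔q r s) r∈U , U-upward-≤ y (ℚ.p≤q⊔p r s) s∈U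
    where
    ⊔-lub-< : ∀ {r s q} → r <ℚ q → s <ℚ q → r ℚ.⊔ s <ℚ q
    ⊔-lub-< {r} {s} r<q s<q with ℚ.⊔-sel r s
    ... | inj₁ eq = subst (_<ℚ _) (sym eq) r<q
    ... | inj₂ eq = subst (_<ℚ _) (sym eq) s<q

  located : ∀ p q → p <ℚ q → (L x p ⊎ L y p) ⊎ (U x q × U y q)
  located p q p<q with ℝ.located x p q p<q | ℝ.located y p q p<q
  ... | inj₁ p∈L | _        = inj₁ (inj₁ p∈L)
  ... | inj₂ _   | inj₁ p∈L = inj₁ (inj₂ p∈L)
  ... | inj₂ q∈U | inj₂ q∈V = inj₂ (q∈U , q∈V)

-- Intervals and boxes

-- Intersection in one dimension, expressed through endpoints rather than a common point. It lives
-- in `Set` and inherits stability from `≤ᴿ`.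
Meets : Interval → Interval → Set
Meets I J = (left I ≤ᴿ right J) × (left J ≤ᴿ right I)

Meets-refl : ∀ I → Meets I I
Meets-refl I = left≤right I , left≤right I

Meets-sym : ∀ {I J} → Meets I J → Meets J I
Meets-sym (a , b) = b , a

Meets-stable : ∀ I J → ¬ ¬ Meets I J → Meets I J
Meets-stable I J ¬¬m =
    ≤ᴿ-stable (left I) (right J) (λ ¬a → ¬¬m (¬a ∘ proj₁))
  , ≤ᴿ-stable (left J) (right I) (λ ¬b → ¬¬m (¬b ∘ proj₂))

Intersect⇔Meets : ∀ {ℓ} (B C : Box ℓ) → Intersect B C ⇔ (∀ d → Meets (B d) (C d))
Intersect⇔Meets B C = mk⇔
  (λ (p , p∈B , p∈C) d →
      (λ q → proj₂ (p∈C d) q ∘ proj₁ (p∈B d) q)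
    , (λ q → proj₂ (p∈B d) q ∘ proj₁ (p∈C d) q))
  -- In each dimension the larger of the two left endpoints is a common point.
  (λ meets → (λ d → left (B d) ⊔ᴿ left (C d))
    , (λ d → (λ _ → inj₁) , λ { q (inj₁ q∈L) → left≤right (B d) q q∈L
                              ; q (inj₂ q∈L) → proj₂ (meets d) q q∈L })
    , (λ d → (λ _ → inj₂) , λ { q (inj₁ q∈L) → proj₁ (meets d) q q∈L
                              ; q (inj₂ q∈L) → left≤right (C d) q q∈L }))

-- J and J′ both contain the gap between I and I′.
Meets-across-gap : ∀ I I′ J J′ → right I ≤ᴿ left I′ →
  Meets I J → Meets I J′ → Meets I′ J → Meets I′ J′ → Meets J J′
Meets-across-gap I I′ J J′ r≤l′ (_ , JI) (_ , J′I) (I′J , _) (I′J′ , _) =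
    (λ q → I′J′ q ∘ r≤l′ q ∘ JI q)
  , (λ q → I′J q ∘ r≤l′ q ∘ J′I q)

-- An interval graph has no induced 4-cycle. The goal is stable, so one may decide whether `I`
-- starts no later than `I′` ends. This tells which of the disjoint intervals lies to the left, and
-- hence where the gap is.
Meets-C₄ : ∀ I I′ J J′ → ¬ Meets I I′ →
  Meets I J → Meets I J′ → Meets I′ J → Meets I′ J′ → Meets J J′
Meets-C₄ I I′ J J′ I∦I′ IJ IJ′ I′J I′J′ =
  Meets-stable J J′ λ J∦J′ → ¬¬-excluded-middle λ
    { (yes l≤r′) →
        let r≤l′ = ≰ᴿ⇒≥ᴿ (left I′) (right I) (λ l′≤r → I∦I′ (l≤r′ , l′≤r))
        in J∦J′ (Meets-across-gap I I′ J J′ r≤l′ IJ IJ′ I′J I′J′)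
    ; (no l≰r′) →
        let r′≤l = ≰ᴿ⇒≥ᴿ (left I) (right I′) l≰r′
        in J∦J′ (Meets-across-gap I′ I J J′ r′≤l I′J I′J′ IJ IJ′)
    }

-- The order is a parameter so that one induction serves for common lower bounds and, with the order
-- reversed, for common upper bounds.
commonWitness : (_≼_ : ℚ → ℚ → Set) → (∀ p q → ∃[ r ] (p ≼ r × q ≼ r)) →
  ∀ {n} {P : Fin n → ℚ → Set} → (∀ i {p q} → p ≼ q → P i p → P i q) →
  (∀ i → ∃ (P i)) → ∃[ q ] (∀ i → P i q)
commonWitness _≼_ directed {zero}  mono inhabited = 0ℚ , λ ()
commonWitness _≼_ directed {suc n} mono inhabited =
  let p , P0p = inhabited zero
      q , Pq  = commonWitness _≼_ directed (mono ∘ suc) (inhabited ∘ suc)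
      r , p≼r , q≼r = directed p q
  in r , λ { zero → mono zero p≼r P0p ; (suc i) → mono (suc i) q≼r (Pq i) }

bounds : ∀ {m k} (I : Fin m → Fin k → Interval) →
  ∃[ p ] ∃[ q ] (p ≤ℚ q × (∀ x d → L (left (I x d)) p) × (∀ x d → U (right (I x d)) q))
bounds I =
  let p , p∈L = commonWitness (flip _≤ℚ_) below
                  (λ x q≤p p∈L d → L-downward-≤ (left (I x d)) q≤p (p∈L d))
                  (λ x → commonWitness (flip _≤ℚ_) below (λ d → L-downward-≤ (left (I x d)))
                           (λ d → ℝ.L-inhabited (left (I x d))))
      q , q∈U = commonWitness _≤ℚ_ above
                  (λ x p≤q p∈U d → U-upward-≤ (right (I x d)) p≤q (p∈U d))
                  (λ x → commonWitness _≤ℚ_ above (λ d → U-upward-≤ (right (I x d)))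
                           (λ d → ℝ.U-inhabited (right (I x d))))
  -- Taking the maximum with `p` gives `p ≤ q` outright, even when there are no intervals to
  -- compare.
  in p , p ℚ.⊔ q , ℚ.p≤p⊔q p q , p∈L , λ x d → U-upward-≤ (right (I x d)) (ℚ.p≤q⊔p p q) (q∈U x d)
  where
  below : ∀ p q → ∃[ r ] (r ≤ℚ p × r ≤ℚ q)
  below p q = p ℚ.⊓ q , ℚ.p⊓q≤p p q , ℚ.p⊓q≤q p q

  above : ∀ p q → ∃[ r ] (p ≤ℚ r × q ≤ℚ r)
  above p q = p ℚ.⊔ q , ℚ.p≤p⊔q p q , ℚ.p≤q⊔p p q

-- Interval representations of graphs

-- The dimensions form an arbitrary type `D`, so the join can use pairs of a vertex `k` of `G` and a
-- dimension of `H k` without arithmetic on indices.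
record Representation {V : Set} (G : Graph V 0ℓ) (D : Set) : Set₁ where
  field
    box       : V → D → Interval
    Adj⇒Meets : ∀ {u v} → Adj G u v → ∀ d → Meets (box u d) (box v d)
    Meets⇒Adj : ∀ {u v} → u ≢ v → (∀ d → Meets (box u d) (box v d)) → Adj G u v

open Representation

fromBoxGraph : ∀ {V : Set} {G : Graph V 0ℓ} {ℓ} → IsBoxGraph G ℓ → Representation G (Fin ℓ)
fromBoxGraph (W , B , iso) = record
  { box       = B′
  ; Adj⇒Meets = λ {u} {v} e → to⇔ (Intersect⇔Meets (B′ u) (B′ v)) (proj₂ (to⇔ (edges _ _) e))
  ; Meets⇒Adj = λ {u} {v} u≢v meets → from⇔ (edges u v)
      (u≢v ∘ ↔-injective vertices , from⇔ (Intersect⇔Meets (B′ u) (B′ v)) meets)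
  }
  where
  open _≅_ iso
  B′ = B ∘ to↔ vertices

toBoxGraph : ∀ {V D : Set} {G : Graph V 0ℓ} {ℓ} → Fin ℓ ↔ D → Representation G D → IsBoxGraph G ℓ
toBoxGraph {V} {G = G} e R = V , B , record
  { vertices = ↔-refl
  ; edges    = λ u v → mk⇔
      (λ uv → (λ { refl → irrefl G uv }) , from⇔ (Intersect⇔Meets (B u) (B v)) (Adj⇒Meets R uv ∘ to↔ e))
      (λ (u≢v , uv) → Meets⇒Adj R u≢v λ d →
        subst (λ d → Meets (box R u d) (box R v d)) (Inverse.strictlyInverseˡ e d)
          (to⇔ (Intersect⇔Meets (B u) (B v)) uv (from↔ e d)))
  }
  where B = λ v → box R v ∘ to↔ e

module _ {n} {m : Fin n → ℕ} {G : Graph (Fin n) 0ℓ} {H : ∀ i → Graph (Fin (m i)) 0ℓ} where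

  join-inner : ∀ {i x y} → Adj (join G H) (i , x) (i , y) → Adj (H i) x y
  join-inner (inj₁ e)          = ⊥-elim (irrefl G e)
  join-inner (inj₂ (refl , e)) = e

  join-outer : ∀ {i j x y} → i ≢ j → Adj (join G H) (i , x) (j , y) → Adj G i j
  join-outer i≢j (inj₁ e)         = e
  join-outer i≢j (inj₂ (i≡j , _)) = contradiction i≡j i≢j

  -- Upper bound

  module _ {β : Fin n → ℕ} (1≤β : ∀ i → 1 ≤ β i) (R : ∀ i → Representation (H i) (Fin (β i)))
           (adj? : ∀ i j → Dec (Adj G i j)) where

    private
      lo hi : Fin n → ℚ
      lo i = proj₁ (bounds (box (R i)))
      hi i = proj₁ (proj₂ (bounds (box (R i))))

      lo≤hi : ∀ i → lo i ≤ℚ hi i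
      lo≤hi i = proj₁ (proj₂ (proj₂ (bounds (box (R i)))))

      lo∈L : ∀ i x c → L (left (box (R i) x c)) (lo i)
      lo∈L i = proj₁ (proj₂ (proj₂ (proj₂ (bounds (box (R i))))))

      hi∈U : ∀ i x c → U (right (box (R i) x c)) (hi i)
      hi∈U i = proj₂ (proj₂ (proj₂ (proj₂ (bounds (box (R i))))))

      outer : ∀ k {A : Set} → Dec A → Interval
      outer k (yes _) = record { left = fromℚ (lo k) ; right = fromℚ (hi k) ; left≤right = fromℚ-mono (lo≤hi k) }
      outer k (no  _) = record { left = fromℚ (hi k) ; right = fromℚ (hi k) ; left≤right = ≤ᴿ-refl {fromℚ (hi k)} }

      -- All outer intervals share the point `hi k`, so the dimensions belonging to `k` never
      -- separate two vertices outside `H k`.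
      outer-meets-outer : ∀ k {A B : Set} (A? : Dec A) (B? : Dec B) → Meets (outer k A?) (outer k B?)
      outer-meets-outer k A? B? = left≤hi A? B? , left≤hi B? A?
        where
        left≤hi : ∀ {A B : Set} (A? : Dec A) (B? : Dec B) → left (outer k A?) ≤ᴿ right (outer k B?)
        left≤hi (yes _) (yes _) = fromℚ-mono (lo≤hi k)
        left≤hi (yes _) (no  _) = fromℚ-mono (lo≤hi k)
        left≤hi (no  _) (yes _) = ≤ᴿ-refl {fromℚ (hi k)}
        left≤hi (no  _) (no  _) = ≤ᴿ-refl {fromℚ (hi k)}

      inner-meets-outer : ∀ k x c {A : Set} (A? : Dec A) → A → Meets (box (R k) x c) (outer k A?)
      inner-meets-outer k x c (yes _) _ =
        (λ q → U⇒≤ᴿfromℚ (right I) (hi∈U k x c) q ∘ left≤right I q) , L⇒fromℚ≤ᴿ (right I) (left≤right I _ (lo∈L k x c))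
        where I = box (R k) x c
      inner-meets-outer k x c (no ¬a) a = ⊥-elim (¬a a)

      -- The point `hi k` lies strictly beyond every right endpoint of `H k`, so only the long
      -- interval of a neighbour can meet an inner one.
      inner-meets-outer⁻ : ∀ k x c {A : Set} (A? : Dec A) → Meets (box (R k) x c) (outer k A?) → A
      inner-meets-outer⁻ k x c (yes a) _ = a
      inner-meets-outer⁻ k x c (no _) (_ , hi≤right) = ⊥-elim (U⇒fromℚ≰ᴿ (right (box (R k) x c)) (hi∈U k x c) hi≤right)

      -- The decision of `k ≡ j` is an argument, so that later proofs can match on it; `k ≟ k` does
      -- not reduce for a variable `k`.
      place : ∀ k → Fin (β k) → ∀ {j} → Dec (k ≡ j) → Fin (m j) → Interval
      place k c (yes refl) y = box (R k) y c
      place k c {j} (no _) y = outer k (adj? k j)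

      place-inner : ∀ i c x (i? : Dec (i ≡ i)) → place i c i? x ≡ box (R i) x c
      place-inner i c x (yes refl) = refl
      place-inner i c x (no i≢i)   = contradiction refl i≢i

      place-outer : ∀ {i j} c y (j? : Dec (i ≡ j)) → i ≢ j → place i c j? y ≡ outer i (adj? i j)
      place-outer c y (yes i≡j) i≢j = contradiction i≡j i≢j
      place-outer c y (no _)    _   = refl

      place-meets : ∀ k c {i j x y} (i? : Dec (k ≡ i)) (j? : Dec (k ≡ j)) →
                    Adj (join G H) (i , x) (j , y) → Meets (place k c i? x) (place k c j? y)
      place-meets k c (yes refl) (yes refl) e = Adj⇒Meets (R k) (join-inner e) c
      place-meets k c {x = x} (yes refl) (no k≢j) e =
        inner-meets-outer k x c (adj? k _) (join-outer k≢j e)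
      place-meets k c {y = y} (no k≢i) (yes refl) e =
        Meets-sym {box (R k) y c} {outer k (adj? k _)}
          (inner-meets-outer k y c (adj? k _) (join-outer k≢i (adj-sym (join G H) e)))
      place-meets k c (no _) (no _) e = outer-meets-outer k (adj? k _) (adj? k _)

    joinRepresentation : Representation (join G H) (Σ[ i ∈ Fin n ] Fin (β i))
    joinRepresentation = record
      { box       = λ (i , x) (k , c) → place k c (k ≟ i) x
      ; Adj⇒Meets = λ {(i , _)} {(j , _)} e (k , c) → place-meets k c (k ≟ i) (k ≟ j) e
      ; Meets⇒Adj = Meets⇒Adj′
      }
      where
      Meets⇒Adj′ : ∀ {u v} → u ≢ v →
        (∀ ((k , c) : Σ[ k ∈ Fin n ] Fin (β k)) →
          Meets (place k c (k ≟ proj₁ u) (proj₂ u)) (place k c (k ≟ proj₁ v) (proj₂ v))) →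
        Adj (join G H) u v
      Meets⇒Adj′ {i , x} {j , y} u≢v meets with i ≟ j
      -- Within one `H i`, the dimensions belonging to `i` already decide adjacency.
      ... | yes refl = inj₂ (refl , Meets⇒Adj (R i) (u≢v ∘ cong (i ,_)) λ c →
        subst₂ Meets (place-inner i c x (i ≟ i)) (place-inner i c y (i ≟ i)) (meets (i , c)))
      -- A single dimension belonging to `i` suffices, and one exists because `β i` is positive.
      ... | no i≢j = inj₁ (inner-meets-outer⁻ i x c (adj? i j)
        (subst₂ Meets (place-inner i c x (i ≟ i)) (place-outer c y (i ≟ j) i≢j) (meets (i , c))))
        where c = 1≤⇒Fin (1≤β i)

  -- Lower bound

  module _ {ℓ} (R : Representation (join G H) (Fin ℓ)) where

    Separates : Fin n → Fin ℓ → Set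
    Separates i d = ∃[ x ] ∃[ y ] ¬ Meets (box R (i , x) d) (box R (i , y) d)

    -- If `i` and `j` were adjacent, every interval over `i` would meet every interval over `j`, and
    -- the two disjoint pairs would form an induced 4-cycle of intervals.
    Separates-nonadjacent : ∀ {i j d} → Separates i d → Separates j d → ¬ Adj G i j
    Separates-nonadjacent {i} {j} {d} (x , x′ , x∦x′) (y , y′ , y∦y′) ij =
      y∦y′ (Meets-C₄ (box R (i , x) d) (box R (i , x′) d) (box R (j , y) d) (box R (j , y′) d)
        x∦x′ (meets x y) (meets x y′) (meets x′ y) (meets x′ y′))
      where
      meets : ∀ x y → Meets (box R (i , x) d) (box R (j , y) d)
      meets x y = Adj⇒Meets R (inj₁ ij) d

    module _ {i} (E : Enumeration (Separates i)) where

      restrict : Representation (H i) (Fin (size E))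
      restrict = record
        { box       = λ x c → box R (i , x) (enum E c)
        ; Adj⇒Meets = λ e c → Adj⇒Meets R (inj₂ (refl , e)) (enum E c)
        ; Meets⇒Adj = λ {x} {y} x≢y meets → join-inner (Meets⇒Adj R (λ { refl → x≢y refl }) λ d →
            -- A dimension in which `x` and `y` fail to meet is separating, hence enumerated, so
            -- nothing is lost by dropping the others.
            Meets-stable (box R (i , x) d) (box R (i , y) d) λ x∦y →
              let c , c≡d = complete E (x , y , x∦y)
              in x∦y (subst (λ d → Meets (box R (i , x) d) (box R (i , y) d)) c≡d (meets c)))
        }

      -- With no separating dimension, `restrict` has no dimensions and makes all distinct vertices
      -- adjacent. Positivity is required because boxicity is minimal among positive dimensions
      -- only.
      1≤separating : ¬ Complete (H i) → 1 ≤ size E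
      1≤separating incomplete = n≢0⇒n>0 λ size≡0 →
        incomplete λ x y x≢y → Meets⇒Adj restrict x≢y λ c → contradiction (subst Fin size≡0 c) ¬Fin0

    cliqueSum≤ : (∀ i d → Dec (Separates i d)) → {β : Fin n → ℕ} → (∀ i → IsBoxicity (H i) (β i)) →
      ∀ {S} → IsClique G S → (∀ i → i ∈ S → ¬ Complete (H i)) → sumOver S β ≤ ℓ
    cliqueSum≤ separates? {β} boxicity {S} (_ , clique) incomplete =
      disjointInjections⇒sum≤ (proj₁ ∘ separating) (λ i → proj₁ (proj₂ (separating i))) disjoint
      where
      E : ∀ i → Enumeration (Separates i)
      E i = enumerate (separates? i)

      -- Membership in `S` is carried along with each chosen dimension so that `disjoint` can appeal
      -- to the clique property.
      separating : ∀ i → Σ[ e ∈ (Fin (if lookup S i then β i else 0) → Fin ℓ) ]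
                         (Injective _≡_ _≡_ e × (∀ c → i ∈ S × Separates i (e c)))
      separating i with lookup S i in eq
      -- Outside `S` the summand is 0 and the map is empty.
      ... | false = (λ ()) , (λ {}) , λ ()
      -- Minimality of `β i` bounds it by the number of separating dimensions; the first `β i` of
      -- these are chosen.
      ... | true  = (λ c → enum (E i) (inject≤ c β≤size))
                  , (λ {c} {c′} → inject≤-injective β≤size β≤size c c′ ∘ injective (E i))
                  , (λ c → i∈S , sound (E i) (inject≤ c β≤size))
        where
        i∈S : i ∈ S
        i∈S = lookup⇒[]= i S eq

        β≤size : β i ≤ size (E i)
        β≤size = proj₂ (boxicity i) _
          (1≤separating (E i) (incomplete i i∈S) , toBoxGraph ↔-refl (restrict (E i)))

      disjoint : ∀ {i j} c c′ → proj₁ (separating i) c ≡ proj₁ (separating j) c′ → i ≡ j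
      disjoint {i} {j} c c′ eq with i ≟ j
      ... | yes i≡j = i≡j
      ... | no  i≢j =
        let i∈S , sepᵢ = proj₂ (proj₂ (separating i)) c
            j∈S , sepⱼ = proj₂ (proj₂ (separating j)) c′
        in contradiction (clique i j i∈S j∈S i≢j)
             (Separates-nonadjacent sepᵢ (subst (Separates j) (sym eq) sepⱼ))

theorem3p1 : (n : ℕ) (G : Graph (Fin n) 0ℓ)
    (m : Fin n → ℕ) (H : ∀ i → Graph (Fin (m i)) 0ℓ) →
    (∃[ i ] (¬ Complete (H i))) →
    (boxH : Fin n → ℕ) → (∀ i → IsBoxicity (H i) (boxH i)) →
    (boxJ : ℕ) → IsBoxicity (join G H) boxJ →
    (M : ℕ) → IsGreatest (IsCliqueSum G H boxH) M →
    (M ≤ boxJ) × (boxJ ≤ sum boxH)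
theorem3p1 n G m H (i₀ , _) boxH boxicityH boxJ ((_ , join-graph) , join-least)
           M ((S , clique , incomplete , refl) , _) = lower , upper
  where
  R : Representation (join G H) (Fin boxJ)
  R = fromBoxGraph join-graph

  1≤boxH : ∀ i → 1 ≤ boxH i
  1≤boxH i = proj₁ (proj₁ (boxicityH i))

  lower : sumOver S boxH ≤ boxJ
  lower = decidable-stable (_ ≤? _) λ M≰boxJ →
    ¬¬-decidable₂ (Separates R) λ separates? →
    M≰boxJ (cliqueSum≤ R separates? boxicityH clique incomplete)

  upper : boxJ ≤ sum boxH
  upper = decidable-stable (_ ≤? _) λ boxJ≰sum →
    ¬¬-decidable₂ (Adj G) λ adj? →
    boxJ≰sum (join-least _
      -- The vertex `i₀` makes the sum positive, as the minimality of `boxJ` demands.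
      ( Fin⇒1≤ (from↔ (sum↔Σ boxH) (i₀ , 1≤⇒Fin (1≤boxH i₀)))
      , toBoxGraph (sum↔Σ boxH)
          (joinRepresentation 1≤boxH (λ i → fromBoxGraph (proj₂ (proj₁ (boxicityH i)))) adj?)))
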